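{- For each integer $n\geq 2$, the Johnson graph $J(n,2)$ satisfies $$\operatorname{tww}(J(n,2))=\operatorname{lb}_1(J(n,2))=\begin{cases}2(n-3)&\text{if } n\geq 5,\\ 0&\text{otherwise.}\end{cases}$$
   Context: The Johnson graph $J(n,2)$ has vertex set the $2$-element subsets of $\{1,\dots,n\}$, two distinct vertices $S,S'$ being adjacent iff $|S\cap S'|=1$. A trigraph is a graph whose edges are colored red or black; a graph is a trigraph with all edges black. For a partition $\mathcal{P}$ of $V(G)$, the quotient trigraph $G/\mathcal{P}$ has vertex set $\mathcal{P}$; two parts $U,W$ are joined by a black edge if every pair $u\in U,w\in W$ is a black edge, are non-adjacent if no such pair is an edge, and are joined by a red edge otherwise. A contraction sequence of an $N$-vertex trigraph $G$ is a sequence $\mathcal{P}_N,\dots,\mathcal{P}_1$ of partitions of $V(G)$ with $\mathcal{P}_N$ discrete and each $\mathcal{P}_i$ obtained from $\mathcal{P}_{i+1}$ by merging two parts; its width is the maximum red degree over all $G/\mathcal{P}_i$; $\operatorname{tww}(G)$ is the minimum width. For $G$ with at least two vertices, $\operatorname{lb}_1(G)$ is the minimum, over all pairs of distinct vertices $u,v$, of the maximum red degree of $G/\mathcal{P}$ where $\mathcal{P}$ is the partition whose only non-singleton part is $\{u,v\}$; for a one-vertex graph $\operatorname{lb}_1(G)=0$. -}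

module Defs where

open import Data.Bool using (Bool; true; false; not; _∧_; if_then_else_)
open import Data.Nat using (ℕ; zero; suc; _+_; _*_; _∸_; _≤_; _<_; _⊔_; _≡ᵇ_; _≤ᵇ_)
open import Data.Fin using (Fin) renaming (_<_ to _<ᶠ_)
open import Data.Fin.Properties using () renaming (_<?_ to _<ᶠ?_)
open import Data.List using (List; []; _∷_; length; map; foldr; concatMap; filterᵇ; deduplicateᵇ; allFin)
open import Data.Product using (Σ; Σ-syntax; _×_; _,_; ∃; ∃-syntax)
open import Data.Sum using (_⊎_)
open import Data.Bool.ListAction using (any)
open import Relation.Binary.PropositionalEquality using (_≡_; _≢_)
open import Relation.Nullary using (yes; no)

-- Finite (simple) graphs, given by a vertex type V, a list `vs`
-- enumerating every vertex exactly once, and a Bool-valued adjacency.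

record FinGraph : Set₁ where
  field
    V   : Set
    vs  : List V
    adj : V → V → Bool

-- Partitions of V(G) are represented by labellings  f : V → ℕ ;
-- the parts are the fibres of f (x, y in the same part iff f x ≡ f y).

module _ (G : FinGraph) where
  open FinGraph G

  order : ℕ
  order = length vs

  someEdge : (V → ℕ) → V → V → Bool
  someEdge f x y = any (λ a → any (λ b → (f a ≡ᵇ f x) ∧ ((f b ≡ᵇ f y) ∧ adj a b)) vs) vs

  someNonEdge : (V → ℕ) → V → V → Bool
  someNonEdge f x y = any (λ a → any (λ b → (f a ≡ᵇ f x) ∧ ((f b ≡ᵇ f y) ∧ not (adj a b))) vs) vs

  redPair : (V → ℕ) → V → V → Bool
  redPair f x y = not (f x ≡ᵇ f y) ∧ (someEdge f x y ∧ someNonEdge f x y)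

  redDeg : (V → ℕ) → V → ℕ
  redDeg f x = length (deduplicateᵇ _≡ᵇ_ (map f (filterᵇ (redPair f x) vs)))

  maxRedDeg : (V → ℕ) → ℕ
  maxRedDeg f = foldr _⊔_ 0 (map (redDeg f) vs)

  Discrete : (V → ℕ) → Set
  Discrete f = ∀ x y → f x ≡ f y → x ≡ y

  MergeOf : (V → ℕ) → (V → ℕ) → Set
  MergeOf f g = Σ[ u ∈ V ] Σ[ v ∈ V ] (f u ≢ f v) ×
    (∀ x y → (g x ≡ g y → (f x ≡ f y ⊎ ((f x ≡ f u × f y ≡ f v) ⊎ (f x ≡ f v × f y ≡ f u))))
           × ((f x ≡ f y ⊎ ((f x ≡ f u × f y ≡ f v) ⊎ (f x ≡ f v × f y ≡ f u))) → g x ≡ g y))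

  ContractionSequence : (ℕ → (V → ℕ)) → Set
  ContractionSequence P =
    Discrete (P order) × (∀ i → 1 ≤ i → i < order → MergeOf (P (suc i)) (P i))

  WidthAtMost : (ℕ → (V → ℕ)) → ℕ → Set
  WidthAtMost P k = ∀ i → 1 ≤ i → i ≤ order → maxRedDeg (P i) ≤ k

  IsTww : ℕ → Set
  IsTww t =
    (Σ[ P ∈ (ℕ → (V → ℕ)) ] ContractionSequence P × WidthAtMost P t)
    × (∀ P k → ContractionSequence P → WidthAtMost P k → t ≤ k)

  PairPartition : V → V → (V → ℕ) → Set
  PairPartition u v f = ∀ x y →
    (f x ≡ f y → (x ≡ y ⊎ ((x ≡ u × y ≡ v) ⊎ (x ≡ v × y ≡ u))))
    × ((x ≡ y ⊎ ((x ≡ u × y ≡ v) ⊎ (x ≡ v × y ≡ u))) → f x ≡ f y)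

  IsLb1 : ℕ → Set
  IsLb1 t =
    (order ≡ 1 × t ≡ 0)
    ⊎ ((Σ[ u ∈ V ] Σ[ v ∈ V ] Σ[ f ∈ (V → ℕ) ] u ≢ v × PairPartition u v f × maxRedDeg f ≡ t)
       × (∀ u v f → u ≢ v → PairPartition u v f → t ≤ maxRedDeg f))

-- The Johnson graph J(n,2): vertices are pairs (j , i , i<j) of elements
-- of Fin n, i.e. the 2-subsets {i, j} of an n-set.

JVertex : ℕ → Set
JVertex n = Σ[ j ∈ Fin n ] Σ[ i ∈ Fin n ] i <ᶠ j

JVertices : (n : ℕ) → List (JVertex n)
JVertices n = concatMap (λ j → concatMap (λ i → pick j i) (allFin n)) (allFin n)
  where
  pick : (j i : Fin n) → List (JVertex n)
  pick j i with i <ᶠ? j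
  ... | yes p = (j , i , p) ∷ []
  ... | no _  = []

private
  eqᶠ : ∀ {n} → Fin n → Fin n → ℕ
  eqᶠ a b = if Data.Fin.toℕ a ≡ᵇ Data.Fin.toℕ b then 1 else 0

JIntersection : ∀ {n} → JVertex n → JVertex n → ℕ
JIntersection (j , i , _) (l , k , _) = eqᶠ i k + eqᶠ i l + eqᶠ j k + eqᶠ j l

Johnson2 : ℕ → FinGraph
Johnson2 n = record
  { V   = JVertex n
  ; vs  = JVertices n
  ; adj = λ S S' → JIntersection S S' ≡ᵇ 1
  }

johnsonValue : ℕ → ℕ
johnsonValue n = if 5 ≤ᵇ n then 2 * (n ∸ 3) else 0

{-# OPTIONS --safe #-}
-- Upper bound. Pass through the partitions in which a growing initial segment T = {0, …, t-1} of
-- the ground set is identified to a point: the parts are E(T), the stars {i} × T for i ∉ T, and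
-- singletons. To add t to T, first merge {t} × T into E(T), then {i, t} into {i} × T for
-- i = t+1, t+2, …. A singleton {i, j} avoiding T ∪ {t} never has a red edge, so a part has at most
-- two red neighbours per index i > t (what is left of {i} × T and {i, t}), none of them with its own
-- index; E(T) itself has a red edge only if t ≥ 2. Every case gives at most 2(n-3).
--
-- Lower bound. The first contraction merges some u ≠ v, and {x, k} is then a red neighbour whenever
-- x lies in exactly one of u, v and k in neither. This gives 2(n-3) red neighbours if u and v meet and
-- 4(n-4) ≥ 2(n-3) if they are disjoint. Conversely, the first contraction of the
-- sequence above merges a single pair, so it attains lb₁.
--
-- For n = 4 merging disjoint pairs creates no red edge, whence the exceptional value 0.
module Submission where

open import Defs
open import Data.Bool using (Bool; true; false; not; _∧_; if_then_else_; T)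
open import Data.Bool.Properties using (T-∧)
open import Data.Bool.ListAction using (any)
open import Data.Empty using (⊥)
open import Data.Nat using (ℕ; zero; suc; _+_; _*_; _∸_; _≤_; _<_; _⊔_; _≡ᵇ_; z≤n; s≤s; s≤s⁻¹; _≤?_)
open import Data.Nat.Properties
open import Data.Fin as Fin using (Fin; zero; suc; toℕ)
open import Data.Fin.Properties as Fin using (toℕ-injective; toℕ<n)
open import Data.List using (List; []; _∷_; length; map; foldr; filter; filterᵇ; deduplicateᵇ; _++_; concatMap; allFin; applyUpTo; cartesianProduct)
open import Data.List.Properties using (length-map; length-++; length-applyUpTo; length-tabulate)
open import Data.List.Membership.Propositional using (_∈_; _∉_; find; lose)
open import Data.List.Membership.Propositional.Properties using (∈-map⁺; ∈-map⁻; ∈-filter⁺; ∈-filter⁻; ∈-map∘filter⁻; ∈-map∘filter⁺; ∈-deduplicate⁻; ∈-∃++; ∈-++⁻; ∈-++⁺ˡ; ∈-++⁺ʳ; ∈-concatMap⁺; ∈-concatMap⁻; ∈-allFin; ∈-applyUpTo⁺; ∈-cartesianProduct⁻)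
import Data.List.Membership.DecPropositional as DecMembership
open import Data.List.Relation.Unary.Any using (here; there)
open import Data.List.Relation.Unary.Any.Properties using (any⁺; any⁻)
open import Data.List.Relation.Unary.All as All using (All; []; _∷_)
open import Data.List.Relation.Unary.All.Properties using (all-filter; ¬Any⇒All¬)
open import Data.List.Relation.Unary.AllPairs as AllPairs using (AllPairs; []; _∷_)
open import Data.List.Relation.Unary.Unique.Propositional using (Unique)
import Data.List.Relation.Unary.Unique.Propositional.Properties as Unique
open import Data.List.Relation.Binary.Subset.Propositional using (_⊆_)
open import Data.List.Relation.Binary.Permutation.Propositional using (↭-sym; ↭⇒↭ₛ)
open import Data.List.Relation.Binary.Permutation.Propositional.Properties using (∈-resp-↭; ↭-length)
import Data.List.Relation.Binary.Permutation.Setoid.Properties as PermSetoid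
open import Data.List.Relation.Unary.Sorted.TotalOrder.Properties using (Sorted⇒AllPairs)
open import Data.List.Sort ≤-decTotalOrder using (sort; sort-↭; sort-↗)
open import Data.Product using (Σ-syntax; _×_; _,_; proj₁; proj₂)
open import Data.Sum using (_⊎_; inj₁; inj₂; [_,_]′)
open import Function.Base using (_∘_; id; _∘₂_)
open import Function.Bundles using (Equivalence)
open import Relation.Binary using (tri<; tri≈; tri>)
open import Relation.Binary.PropositionalEquality using (_≡_; _≢_; refl; sym; trans; cong; cong₂; subst; subst₂; setoid; module ≡-Reasoning)
open import Relation.Nullary using (¬_; yes; no; contradiction; Dec; does; T?; ¬?)

if-yes : {P A : Set} (P? : Dec P) {a b : A} → P → (if does P? then a else b) ≡ a
if-yes (yes _) p = refl
if-yes (no ¬p) p = contradiction p ¬p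

if-no : {P A : Set} (P? : Dec P) {a b : A} → ¬ P → (if does P? then a else b) ≡ b
if-no (yes p) ¬p = contradiction p ¬p
if-no (no _) ¬p = refl

-- Lists without repetition

-- Pigeonhole, behind both the upper and the lower estimates of red degrees.
unique-⊆⇒length≤ : {A : Set} {xs ys : List A} → Unique xs → xs ⊆ ys → length xs ≤ length ys
unique-⊆⇒length≤ {xs = []} _ _ = z≤n
unique-⊆⇒length≤ {xs = x ∷ xs} (x≢ ∷ uxs) sub with ∈-∃++ (sub (here refl))
... | ps , qs , refl = subst (suc (length xs) ≤_) eq (s≤s (unique-⊆⇒length≤ uxs sub′))
  where
  sub′ : xs ⊆ ps ++ qs
  sub′ y∈xs with ∈-++⁻ ps (sub (there y∈xs))
  ... | inj₁ y∈ps = ∈-++⁺ˡ y∈ps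
  ... | inj₂ (here refl) = contradiction refl (All.lookup x≢ y∈xs)
  ... | inj₂ (there y∈qs) = ∈-++⁺ʳ ps y∈qs

  eq : suc (length (ps ++ qs)) ≡ length (ps ++ x ∷ qs)
  eq = begin
    suc (length (ps ++ qs))     ≡⟨ cong suc (length-++ ps) ⟩
    suc (length ps + length qs) ≡⟨ +-suc (length ps) (length qs) ⟨
    length ps + suc (length qs) ≡⟨ length-++ ps ⟨
    length (ps ++ x ∷ qs)       ∎
    where open ≡-Reasoning

unique-∷ : {A : Set} {x : A} {xs : List A} → x ∉ xs → Unique xs → Unique (x ∷ xs)
unique-∷ x∉ u = ¬Any⇒All¬ _ x∉ ∷ u

unique-map-∈ : {A B : Set} (f : A → B) {xs : List A} →
  (∀ {x y} → x ∈ xs → y ∈ xs → f x ≡ f y → x ≡ y) → Unique xs → Unique (map f xs)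
unique-map-∈ f inj [] = []
unique-map-∈ f inj (x≢ ∷ u) =
  unique-∷ (λ fx∈ → let y , y∈ , fx≡fy = ∈-map⁻ f fx∈
                    in All.lookup x≢ y∈ (inj (here refl) (there y∈) fx≡fy))
           (unique-map-∈ f (λ p q → inj (there p) (there q)) u)

dedupᵇ-unique : ∀ xs → Unique (deduplicateᵇ _≡ᵇ_ xs)
dedupᵇ-unique [] = []
dedupᵇ-unique (x ∷ xs) =
  All.map (λ x≢ᵇ → λ x≡ → x≢ᵇ (≡⇒≡ᵇ _ _ x≡))
          (all-filter (¬? ∘ (T? ∘₂ _≡ᵇ_) x) (deduplicateᵇ _≡ᵇ_ xs))
  ∷ Unique.filter⁺ _ (dedupᵇ-unique xs)

∈-dedupᵇ⁺ : ∀ {z} xs → z ∈ xs → z ∈ deduplicateᵇ _≡ᵇ_ xs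
∈-dedupᵇ⁺ (x ∷ xs) (here refl) = here refl
∈-dedupᵇ⁺ {z} (x ∷ xs) (there z∈) with x ≟ z
... | yes refl = here refl
... | no x≢z = there (∈-filter⁺ _ (∈-dedupᵇ⁺ xs z∈) (x≢z ∘ ≡ᵇ⇒≡ x z))

foldr-⊔-lub : ∀ {k} xs → (∀ {x} → x ∈ xs → x ≤ k) → foldr _⊔_ 0 xs ≤ k
foldr-⊔-lub [] _ = z≤n
foldr-⊔-lub (x ∷ xs) b = ⊔-lub (b (here refl)) (foldr-⊔-lub xs (b ∘ there))

∈⇒≤foldr-⊔ : ∀ {x} xs → x ∈ xs → x ≤ foldr _⊔_ 0 xs
∈⇒≤foldr-⊔ (x ∷ xs) (here refl) = m≤m⊔n x _
∈⇒≤foldr-⊔ (x ∷ xs) (there p) = ≤-trans (∈⇒≤foldr-⊔ xs p) (m≤n⊔m x _)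

-- Returns 0 out of range.

nth : List ℕ → ℕ → ℕ
nth [] _ = 0
nth (x ∷ _) zero = x
nth (_ ∷ xs) (suc m) = nth xs m

nth-∈ : ∀ {xs m} → m < length xs → nth xs m ∈ xs
nth-∈ {_ ∷ _} {zero} _ = here refl
nth-∈ {_ ∷ _} {suc m} (s≤s m<) = there (nth-∈ m<)

nth-zero-least : ∀ {xs x} → AllPairs _<_ xs → x ∈ xs → nth xs 0 ≤ x
nth-zero-least _ (here refl) = ≤-refl
nth-zero-least (x< ∷ _) (there y∈) = <⇒≤ (All.lookup x< y∈)

nth-suc-< : ∀ {xs m} → AllPairs _<_ xs → suc m < length xs → nth xs m < nth xs (suc m)
nth-suc-< {_ ∷ _} {zero} (x< ∷ _) (s≤s m<) = All.lookup x< (nth-∈ m<)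
nth-suc-< {_ ∷ _} {suc m} (_ ∷ ap) (s≤s m<) = nth-suc-< ap m<

-- For the sorted keys this means that passing to the next threshold absorbs exactly one vertex; it
-- supplies the hypothesis `gap` of the absorption.
nth-gap : ∀ {xs m x} → AllPairs _<_ xs → suc m < length xs → x ∈ xs →
  x ≤ nth xs m ⊎ nth xs (suc m) ≤ x
nth-gap {_ ∷ _} {zero} _ _ (here refl) = inj₁ ≤-refl
nth-gap {_ ∷ _} {zero} (_ ∷ ap) _ (there x∈) = inj₂ (nth-zero-least ap x∈)
nth-gap {_ ∷ _} {suc m} (x< ∷ _) (s≤s m<) (here refl) =
  inj₁ (<⇒≤ (All.lookup x< (nth-∈ (<-trans (n<1+n m) m<))))
nth-gap {_ ∷ _} {suc m} (_ ∷ ap) (s≤s m<) (there x∈) = nth-gap ap m< x∈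

sort-strict : ∀ {xs} → Unique xs → AllPairs _<_ (sort xs)
sort-strict {xs} u = AllPairs.zipWith (λ (p , q) → ≤∧≢⇒< p q)
  ( Sorted⇒AllPairs ≤-totalOrder (sort-↗ xs)
  , PermSetoid.Unique-resp-↭ (setoid ℕ) (↭⇒↭ₛ (↭-sym (sort-↭ xs))) u)

-- Red degrees

module RedDegree (G : FinGraph) where
  open FinGraph G

  -- `redPair` with its witnesses named: `a`, `b` give an edge and `c`, `d` a non-edge between the
  -- two fibres. Membership in `vs` is left out, so only the passage back to `redPair` asks for a
  -- complete enumeration.
  record Red (f : V → ℕ) (x y : V) : Set where
    constructor red
    field
      labels≢ : f x ≢ f y
      a b c d : V
      fa : f a ≡ f x
      fb : f b ≡ f y
      edge : adj a b ≡ true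
      fc : f c ≡ f x
      fd : f d ≡ f y
      non-edge : adj c d ≡ false

  private
    T⇒≡ : ∀ {b} → T b → b ≡ true
    T⇒≡ {true} _ = refl

    T-not⇒≡ : ∀ {b} → T (not b) → b ≡ false
    T-not⇒≡ {false} _ = refl

    ≡⇒T : ∀ {b} → b ≡ true → T b
    ≡⇒T refl = _

    ≡⇒T-not : ∀ {b} → b ≡ false → T (not b)
    ≡⇒T-not refl = _

    ∧⁻ : ∀ {x y} → T (x ∧ y) → T x × T y
    ∧⁻ = Equivalence.to T-∧

    ∧⁺ : ∀ {x y} → T x → T y → T (x ∧ y)
    ∧⁺ p q = Equivalence.from T-∧ (p , q)

    any²⁻ : (f : V → ℕ) (e : V → V → Bool) (x y : V) →
      T (any (λ a → any (λ b → (f a ≡ᵇ f x) ∧ ((f b ≡ᵇ f y) ∧ e a b)) vs) vs) →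
      Σ[ a ∈ V ] Σ[ b ∈ V ] f a ≡ f x × f b ≡ f y × T (e a b)
    any²⁻ f e x y t =
      let a , _ , ta = find (any⁻ _ vs t)
          b , _ , tb = find (any⁻ _ vs ta)
          fa , rest = ∧⁻ {f a ≡ᵇ f x} tb
          fb , te = ∧⁻ {f b ≡ᵇ f y} rest
      in a , b , ≡ᵇ⇒≡ _ _ fa , ≡ᵇ⇒≡ _ _ fb , te

    any²⁺ : (f : V → ℕ) (e : V → V → Bool) (x y : V) {a b : V} → a ∈ vs → b ∈ vs →
      f a ≡ f x → f b ≡ f y → T (e a b) →
      T (any (λ a → any (λ b → (f a ≡ᵇ f x) ∧ ((f b ≡ᵇ f y) ∧ e a b)) vs) vs)
    any²⁺ f e x y {a} {b} a∈ b∈ fa fb te =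
      any⁺ _ (lose a∈ (any⁺ _ (lose b∈
        (∧⁺ {f a ≡ᵇ f x} (≡⇒≡ᵇ _ _ fa) (∧⁺ {f b ≡ᵇ f y} (≡⇒≡ᵇ _ _ fb) te)))))

  redPair⁻ : ∀ f x y → T (redPair G f x y) → Red f x y
  redPair⁻ f x y t =
    let t₁ , t₂₃ = ∧⁻ {not (f x ≡ᵇ f y)} t
        t₂ , t₃ = ∧⁻ {someEdge G f x y} t₂₃
        a , b , fa , fb , e = any²⁻ f adj x y t₂
        c , d , fc , fd , ne = any²⁻ f (λ a b → not (adj a b)) x y t₃
    in red (λ eq → case-not t₁ (≡⇒≡ᵇ _ _ eq)) a b c d fa fb (T⇒≡ e) fc fd (T-not⇒≡ ne)
    where
    case-not : ∀ {b} → T (not b) → T b → ⊥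
    case-not {true} ()
    case-not {false} _ ()

  module Complete (complete : ∀ v → v ∈ vs) where

    redPair⁺ : ∀ f x y → Red f x y → T (redPair G f x y)
    redPair⁺ f x y (red l a b c d fa fb e fc fd ne) =
      ∧⁺ {not (f x ≡ᵇ f y)} (≡⇒T-not (≢⇒false l))
        (∧⁺ {someEdge G f x y}
          (any²⁺ f adj x y (complete a) (complete b) fa fb (≡⇒T e))
          (any²⁺ f (λ a b → not (adj a b)) x y (complete c) (complete d) fc fd (≡⇒T-not ne)))
      where
      ≢⇒false : ∀ {m n} → m ≢ n → (m ≡ᵇ n) ≡ false
      ≢⇒false {m} {n} m≢n with m ≡ᵇ n in eq
      ... | false = refl
      ... | true = contradiction (≡ᵇ⇒≡ m n (≡⇒T eq)) m≢n

    -- Red degree counts labels rather than vertices, so the listed neighbours have to lie in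
    -- pairwise different parts.
    redDeg-≥ : ∀ f x {ws} → Unique (map f ws) → (∀ {w} → w ∈ ws → Red f x w) → length ws ≤ redDeg G f x
    redDeg-≥ f x {ws} u r = subst (_≤ redDeg G f x) (length-map f ws) (unique-⊆⇒length≤ u sub)
      where
      sub : map f ws ⊆ deduplicateᵇ _≡ᵇ_ (map f (filterᵇ (redPair G f x) vs))
      sub l∈ with ∈-map⁻ f l∈
      ... | w , w∈ , eq = ∈-dedupᵇ⁺ _ (∈-map∘filter⁺ f _ (w , complete w , eq , redPair⁺ f x w (r w∈)))

    redDeg≤maxRedDeg : ∀ f x → redDeg G f x ≤ maxRedDeg G f
    redDeg≤maxRedDeg f x = ∈⇒≤foldr-⊔ _ (∈-map⁺ (redDeg G f) (complete x))

  -- The labels of the red neighbours and `es` are disjoint repetition-free lists inside `ys`, hence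
  -- so is their concatenation. The list `es` serves to discount candidate labels that are known not
  -- to be red.
  redDeg-≤-minus : ∀ f x {es ys} → Unique es → es ⊆ ys →
    (∀ y → Red f x y → f y ∈ ys × f y ∉ es) → length es + redDeg G f x ≤ length ys
  redDeg-≤-minus f x {es} {ys} ues es⊆ys bound = subst (_≤ length ys) (length-++ es)
    (unique-⊆⇒length≤ (Unique.++⁺ ues (dedupᵇ-unique _) λ (l∈es , l∈) → proj₂ (place l∈) l∈es) sub)
    where
    labels : List ℕ
    labels = deduplicateᵇ _≡ᵇ_ (map f (filterᵇ (redPair G f x) vs))

    place : ∀ {k} → k ∈ labels → k ∈ ys × k ∉ es
    place k∈ with ∈-map∘filter⁻ f (T? ∘ redPair G f x) {f} {vs} (∈-deduplicate⁻ _ _ k∈)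
    ... | y , _ , refl , t = bound y (redPair⁻ f x y t)

    sub : es ++ labels ⊆ ys
    sub k∈ with ∈-++⁻ es k∈
    ... | inj₁ k∈es = es⊆ys k∈es
    ... | inj₂ k∈labels = proj₁ (place k∈labels)

  maxRedDeg-≤ : ∀ f {k} → (∀ x → redDeg G f x ≤ k) → maxRedDeg G f ≤ k
  maxRedDeg-≤ f b = foldr-⊔-lub (map (redDeg G f) vs) (λ l∈ → let x , _ , eq = ∈-map⁻ (redDeg G f) l∈ in subst (_≤ _) (sym eq) (b x))

-- Contraction sequences

module Contraction (G : FinGraph) where
  open FinGraph G

  -- A merge realised by relabelling: the fibre of `u` takes over the label of `v` and nothing else
  -- changes, so only these two fibres can become equal.
  mergeOf : (f g : V → ℕ) (u v : V) → f u ≢ f v →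
    (∀ x → f x ≡ f u → g x ≡ f v) → (∀ x → f x ≢ f u → g x ≡ f x) → MergeOf G f g
  mergeOf f g u v u≢v moved kept = u , v , u≢v , λ x y → to x y , from x y
    where
    to : ∀ x y → g x ≡ g y → (f x ≡ f y ⊎ ((f x ≡ f u × f y ≡ f v) ⊎ (f x ≡ f v × f y ≡ f u)))
    to x y eq with f x ≟ f u | f y ≟ f u
    ... | yes p | yes q = inj₁ (trans p (sym q))
    ... | yes p | no q = inj₂ (inj₁ (p , trans (sym (kept y q)) (trans (sym eq) (moved x p))))
    ... | no p | yes q = inj₂ (inj₂ (trans (sym (kept x p)) (trans eq (moved y q)) , q))
    ... | no p | no q = inj₁ (trans (sym (kept x p)) (trans eq (kept y q)))

    across : ∀ x y → f x ≡ f u → f y ≡ f v → g x ≡ g y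
    across x y p q = trans (moved x p) (sym (trans (kept y (λ r → u≢v (trans (sym r) q))) q))

    from : ∀ x y → (f x ≡ f y ⊎ ((f x ≡ f u × f y ≡ f v) ⊎ (f x ≡ f v × f y ≡ f u))) → g x ≡ g y
    from x y (inj₁ eq) with f x ≟ f u
    ... | yes p = trans (moved x p) (sym (moved y (trans (sym eq) p)))
    ... | no p = trans (kept x p) (trans eq (sym (kept y (p ∘ trans eq))))
    from x y (inj₂ (inj₁ (p , q))) = across x y p q
    from x y (inj₂ (inj₂ (p , q))) = sym (across y x q p)

  -- Every contraction sequence passes through a partition whose only non-singleton part is a pair,
  -- so `lower` bounds its width. The given sequence has width at most t, hence its own first
  -- contraction has maximum red degree exactly t and attains the minimum over pairs.
  tww-and-lb₁ : ∀ {t} → 2 ≤ order G →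
    (Σ[ P ∈ (ℕ → V → ℕ) ] ContractionSequence G P × WidthAtMost G P t) →
    (∀ u v f → u ≢ v → PairPartition G u v f → t ≤ maxRedDeg G f) →
    IsTww G t × IsLb1 G t
  tww-and-lb₁ {t} 2≤N (P , seq , width) lower =
    ((P , seq , width) , λ Q k seqQ widthQ →
       let u , v , u≢v , pp = first Q seqQ
       in ≤-trans (lower u v _ u≢v pp) (widthQ N-1 1≤N-1 (<⇒≤ N-1<N)))
    , inj₂ ((let u , v , u≢v , pp = first P seq
             in u , v , P N-1 , u≢v , pp , ≤-antisym (width N-1 1≤N-1 (<⇒≤ N-1<N)) (lower u v _ u≢v pp))
           , lower)
    where
    N-1 : ℕ
    N-1 = order G ∸ 1

    1≤N-1 : 1 ≤ N-1
    1≤N-1 = ∸-monoˡ-≤ 1 2≤N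

    suc-N-1 : suc N-1 ≡ order G
    suc-N-1 = m+[n∸m]≡n (≤-trans (s≤s z≤n) 2≤N)

    N-1<N : N-1 < order G
    N-1<N = ≤-reflexive suc-N-1

    -- The partition indexed by `order G` is discrete, so merging two of its parts merges two
    -- vertices.
    first : ∀ Q → ContractionSequence G Q → Σ[ u ∈ V ] Σ[ v ∈ V ] u ≢ v × PairPartition G u v (Q N-1)
    first Q (discrete , steps) with subst (λ m → MergeOf G (Q m) (Q N-1)) suc-N-1 (steps N-1 1≤N-1 N-1<N)
    ... | u , v , fu≢fv , merge = u , v , fu≢fv ∘ cong (Q (order G)) , λ x y →
        (λ eq → down x y (proj₁ (merge x y) eq)) , (λ c → proj₂ (merge x y) (up x y c))
      where
      f : V → ℕ
      f = Q (order G)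

      down : ∀ x y → (f x ≡ f y ⊎ ((f x ≡ f u × f y ≡ f v) ⊎ (f x ≡ f v × f y ≡ f u))) →
        (x ≡ y ⊎ ((x ≡ u × y ≡ v) ⊎ (x ≡ v × y ≡ u)))
      down x y (inj₁ p) = inj₁ (discrete _ _ p)
      down x y (inj₂ (inj₁ (p , q))) = inj₂ (inj₁ (discrete _ _ p , discrete _ _ q))
      down x y (inj₂ (inj₂ (p , q))) = inj₂ (inj₂ (discrete _ _ p , discrete _ _ q))

      up : ∀ x y → (x ≡ y ⊎ ((x ≡ u × y ≡ v) ⊎ (x ≡ v × y ≡ u))) →
        (f x ≡ f y ⊎ ((f x ≡ f u × f y ≡ f v) ⊎ (f x ≡ f v × f y ≡ f u)))
      up x y (inj₁ p) = inj₁ (cong f p)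
      up x y (inj₂ (inj₁ (p , q))) = inj₂ (inj₁ (cong f p , cong f q))
      up x y (inj₂ (inj₂ (p , q))) = inj₂ (inj₂ (cong f p , cong f q))

-- Vertices are absorbed in the order of their keys: once key x is passed, x joins the part of
-- parent x, or that of root if parent x has been absorbed as well (or is x itself).

module Absorption
  (G : FinGraph)
  (complete : ∀ v → v ∈ FinGraph.vs G) (unique : Unique (FinGraph.vs G))
  (key : FinGraph.V G → ℕ) (key-injective : ∀ {x y} → key x ≡ key y → x ≡ y)
  (parent : FinGraph.V G → FinGraph.V G) (parent-idem : ∀ x → parent (parent x) ≡ parent x)
  (root : FinGraph.V G) (parent-root : parent root ≡ root) (root-least : ∀ x → key root ≤ key x)
  where
  open FinGraph G
  open Contraction G

  -- The label 0 is reserved for the part of `root`; every other part carries the successor of its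
  -- representative's key, which is never 0.
  top : ℕ → V → ℕ
  top c x = if does (key x ≤? c) then 0 else suc (key x)

  label : ℕ → V → ℕ
  label c x = if does (key x ≤? c) then top c (parent x) else suc (key x)

  top-≤ : ∀ {c x} → key x ≤ c → top c x ≡ 0
  top-≤ p = if-yes (_ ≤? _) p

  top-> : ∀ {c x} → c < key x → top c x ≡ suc (key x)
  top-> p = if-no (_ ≤? _) (<⇒≱ p)

  label-≤ : ∀ {c x} → key x ≤ c → label c x ≡ top c (parent x)
  label-≤ p = if-yes (_ ≤? _) p

  label-> : ∀ {c x} → c < key x → label c x ≡ suc (key x)
  label-> p = if-no (_ ≤? _) (<⇒≱ p)

  label-root : ∀ {c} → key root ≤ c → label c root ≡ 0
  label-root p = trans (label-≤ p) (trans (cong (top _) parent-root) (top-≤ p))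

  -- At this threshold `root`, having the least key, is the only absorbed vertex and the only one
  -- labelled 0.
  label-discrete : ∀ {c} → c ≡ key root → Discrete G (label c)
  label-discrete {c} refl x y eq with ≤-<-connex (key x) c | ≤-<-connex (key y) c
  ... | inj₁ p | inj₁ q = key-injective (trans (≤-antisym p (root-least x)) (≤-antisym (root-least y) q))
  ... | inj₂ p | inj₂ q = key-injective (suc-injective (trans (sym (label-> p)) (trans eq (label-> q))))
  ... | inj₁ p | inj₂ q with refl ← key-injective {x} {root} (≤-antisym p (root-least x)) =
    contradiction (trans (sym (label-root p)) (trans eq (label-> q))) 0≢1+n
  label-discrete {c} refl x y eq | inj₂ p | inj₁ q with refl ← key-injective {y} {root} (≤-antisym q (root-least y)) =
    contradiction (trans (sym (label-root q)) (trans (sym eq) (label-> p))) 0≢1+n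

  module _ {c} (w : V) (c<w : c < key w) (gap : ∀ x → key x ≤ c ⊎ key w ≤ key x) where

    -- Such an `x` is `w` itself or an absorbed vertex with parent `w`; in the second case
    -- idempotence makes `w` its own parent, so both end with the same `top` label.
    moved : ∀ x → label c x ≡ suc (key w) → label (key w) x ≡ label (key w) w
    moved x eq with gap x
    ... | inj₂ w≤x =
      cong (label (key w)) (key-injective (suc-injective (trans (sym (label-> (<-≤-trans c<w w≤x))) eq)))
    ... | inj₁ x≤c with gap (parent x)
    ...   | inj₁ px≤c = contradiction (trans (sym (trans (label-≤ x≤c) (top-≤ px≤c))) eq) 0≢1+n
    ...   | inj₂ w≤px = begin
      label (key w) x          ≡⟨ label-≤ (≤-trans x≤c (<⇒≤ c<w)) ⟩
      top (key w) (parent x)   ≡⟨ cong (top (key w)) (trans (sym (parent-idem x)) (cong parent px≡w)) ⟩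
      top (key w) (parent w)   ≡⟨ label-≤ ≤-refl ⟨
      label (key w) w          ∎
      where
      open ≡-Reasoning
      px≡w : parent x ≡ w
      px≡w = key-injective (suc-injective
        (trans (sym (trans (label-≤ x≤c) (top-> (<-≤-trans c<w w≤px)))) eq))

    kept : ∀ x → label c x ≢ suc (key w) → label (key w) x ≡ label c x
    kept x neq with gap x
    ... | inj₂ w≤x = trans (label-> (≤∧≢⇒< w≤x w≢x)) (sym lc)
      where
      lc : label c x ≡ suc (key x)
      lc = label-> (<-≤-trans c<w w≤x)
      w≢x : key w ≢ key x
      w≢x eq = neq (trans lc (cong suc (sym eq)))
    ... | inj₁ x≤c with gap (parent x)
    ...   | inj₁ px≤c = trans (trans (label-≤ (≤-trans x≤c (<⇒≤ c<w))) (top-≤ (≤-trans px≤c (<⇒≤ c<w))))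
                              (sym (trans (label-≤ x≤c) (top-≤ px≤c)))
    ...   | inj₂ w≤px = trans (trans (label-≤ (≤-trans x≤c (<⇒≤ c<w))) (top-> (≤∧≢⇒< w≤px w≢px))) (sym lc)
      where
      lc : label c x ≡ suc (key (parent x))
      lc = trans (label-≤ x≤c) (top-> (<-≤-trans c<w w≤px))
      w≢px : key w ≢ key (parent x)
      w≢px eq = neq (trans lc (cong suc (sym eq)))

    -- The part that `w` joins: that of `root` if its parent is absorbed by now, in particular if
    -- `w` is its own parent, and that of `parent w` otherwise.
    target : key root ≤ c → Σ[ v ∈ V ] label c v ≢ suc (key w) × label (key w) w ≡ label c v
    target root≤c with <-≤-connex (key w) (key (parent w))
    ... | inj₂ pw≤w = root
      , (λ eq → 0≢1+n (trans (sym (label-root root≤c)) eq))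
      , trans (trans (label-≤ ≤-refl) (top-≤ pw≤w)) (sym (label-root root≤c))
    ... | inj₁ w<pw = parent w
      , (λ eq → <⇒≢ w<pw (sym (suc-injective (trans (sym lc) eq))))
      , trans (trans (label-≤ ≤-refl) (top-> w<pw)) (sym lc)
      where
      lc : label c (parent w) ≡ suc (key (parent w))
      lc = label-> (<-trans c<w w<pw)

    label-merge : key root ≤ c → MergeOf G (label c) (label (key w))
    label-merge root≤c with target root≤c
    ... | v , v≢ , w≡v = mergeOf _ _ w v
      (λ eq → v≢ (trans (sym eq) (label-> c<w)))
      (λ x eq → trans (moved x (trans eq (label-> c<w))) w≡v)
      (λ x neq → kept x (λ eq → neq (trans eq (sym (label-> c<w)))))

  keys : List ℕ
  keys = sort (map key vs)

  keys-length : length keys ≡ order G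
  keys-length = trans (↭-length (sort-↭ _)) (length-map key vs)

  keys-strict : AllPairs _<_ keys
  keys-strict = sort-strict (Unique.map⁺ key-injective unique)

  key∈keys : ∀ x → key x ∈ keys
  key∈keys x = ∈-resp-↭ (↭-sym (sort-↭ _)) (∈-map⁺ key (complete x))

  nth-keys : ∀ {m} → m < order G → Σ[ w ∈ V ] nth keys m ≡ key w
  nth-keys m< with ∈-map⁻ key (∈-resp-↭ (sort-↭ _) (nth-∈ (subst (_ <_) (sym keys-length) m<)))
  ... | w , _ , eq = w , eq

  sequence : ∀ {k} → (∀ w → maxRedDeg G (label (key w)) ≤ k) →
    Σ[ P ∈ (ℕ → V → ℕ) ] ContractionSequence G P × WidthAtMost G P k
  sequence {k} width = P , (discrete , merges) , bound
    where
    N : ℕ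
    N = order G

    P : ℕ → V → ℕ
    -- Position 0, reached at i = N, holds the key of `root` and gives the discrete partition; each
    -- further position performs one merge. For 1 ≤ i ≤ N the position stays in range.
    P i = label (nth keys (N ∸ i))

    root≤nth : ∀ {m} → m < N → key root ≤ nth keys m
    root≤nth m< = let w , eq = nth-keys m< in subst (key root ≤_) (sym eq) (root-least w)

    0<N : 0 < N
    0<N = nonempty (complete root)
      where
      nonempty : ∀ {x : V} {xs} → x ∈ xs → 0 < length xs
      nonempty (here _) = s≤s z≤n
      nonempty (there _) = s≤s z≤n

    discrete : Discrete G (P N)
    discrete = label-discrete (trans (cong (nth keys) (n∸n≡0 N))
      (≤-antisym (nth-zero-least keys-strict (key∈keys root)) (root≤nth 0<N)))

    mergeAt : ∀ m → suc m < N → MergeOf G (label (nth keys m)) (label (nth keys (suc m)))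
    mergeAt m m<N with nth-keys m<N
    ... | w , eq rewrite eq = label-merge w
        (subst (nth keys m <_) eq (nth-suc-< keys-strict m<))
        (λ x → subst (λ k → key x ≤ nth keys m ⊎ k ≤ key x) eq (nth-gap keys-strict m< (key∈keys x)))
        (root≤nth (<-trans (n<1+n m) m<N))
      where
      m< : suc m < length keys
      m< = subst (suc m <_) (sym keys-length) m<N

    merges : ∀ i → 1 ≤ i → i < N → MergeOf G (P (suc i)) (P i)
    merges i 1≤i i<N = subst (λ m → MergeOf G (P (suc i)) (label (nth keys m))) (sym suc-m)
      (mergeAt (N ∸ suc i) (subst (_< N) suc-m (∸-monoʳ-< 1≤i (<⇒≤ i<N))))
      where
      suc-m : N ∸ i ≡ suc (N ∸ suc i)
      suc-m = +-∸-assoc 1 i<N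

    bound : WidthAtMost G P k
    bound i 1≤i i≤N with nth-keys (∸-monoʳ-< 1≤i i≤N)
    ... | w , eq = subst (λ c → maxRedDeg G (label c) ≤ k) (sym eq) (width w)

-- Vertices and adjacency of J(n,2)

-- `origin` reads off from an element the block it came from, so blocks of distinct indices are
-- disjoint.
unique-concatMap : {A B : Set} (f : A → List B) (origin : B → A) →
  (∀ {a b} → b ∈ f a → origin b ≡ a) → (∀ a → Unique (f a)) →
  ∀ {xs} → Unique xs → Unique (concatMap f xs)
unique-concatMap f origin o u [] = []
unique-concatMap f origin o u {x ∷ xs} (x≢ ∷ uxs) =
  Unique.++⁺ (u x) (unique-concatMap f origin o u uxs) λ (b∈fx , b∈rest) →
    let a , a∈ , b∈fa = find (∈-concatMap⁻ f b∈rest)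
    in All.lookup x≢ a∈ (trans (sym (o b∈fx)) (o b∈fa))

module _ {n : ℕ} where

  hi lo : JVertex n → Fin n
  hi v = proj₁ v
  lo v = proj₁ (proj₂ v)

  h l : JVertex n → ℕ
  h v = toℕ (hi v)
  l v = toℕ (lo v)

  l<h : ∀ v → l v < h v
  l<h v = proj₂ (proj₂ v)

  h<n : ∀ v → h v < n
  h<n v = toℕ<n (hi v)

  vertex-≡ : ∀ {x y : JVertex n} → h x ≡ h y → l x ≡ l y → x ≡ y
  vertex-≡ {_ , _ , p} {_ , _ , q} hx≡hy lx≡ly with refl ← toℕ-injective hx≡hy | refl ← toℕ-injective lx≡ly =
    cong (λ r → _ , _ , r) (<-irrelevant p q)

-- The local function `pick` of JVertices, recovered by unification.

pick : ∀ n → Σ[ g ∈ (Fin n → Fin n → List (JVertex n)) ]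
  JVertices n ≡ concatMap (λ j → concatMap (λ i → g j i) (allFin n)) (allFin n)
pick n = _ , refl

module _ {n : ℕ} where

  pick⁺ : ∀ {j i : Fin n} (i<j : i Fin.< j) → (j , i , i<j) ∈ proj₁ (pick n) j i
  pick⁺ {j} {i} i<j with i Fin.<? j
  ... | yes q = here (cong (λ r → j , i , r) (<-irrelevant i<j q))
  ... | no ¬q = contradiction i<j ¬q

  pick⁻ : ∀ {j i v} → v ∈ proj₁ (pick n) j i → hi v ≡ j × lo v ≡ i
  pick⁻ {j} {i} v∈ with i Fin.<? j
  pick⁻ (here refl) | yes _ = refl , refl

  pick-unique : ∀ j i → Unique (proj₁ (pick n) j i)
  pick-unique j i with i Fin.<? j
  ... | yes _ = [] ∷ []
  ... | no _ = []

JVertices-complete : ∀ {n} (v : JVertex n) → v ∈ JVertices n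
JVertices-complete {n} (j , i , i<j) =
  ∈-concatMap⁺ _ (lose (∈-allFin j) (∈-concatMap⁺ (proj₁ (pick n) j) (lose (∈-allFin i) (pick⁺ i<j))))

JVertices-unique : ∀ n → Unique (JVertices n)
JVertices-unique n = unique-concatMap _ hi
  (λ {j} v∈ → let _ , _ , v∈p = find (∈-concatMap⁻ (proj₁ (pick n) j) {allFin n} v∈) in proj₁ (pick⁻ v∈p))
  (λ j → unique-concatMap (proj₁ (pick n) j) lo (proj₂ ∘ pick⁻) (pick-unique j) (Unique.allFin⁺ n))
  (Unique.allFin⁺ n)

-- Definitionally the private Kronecker delta inside `JIntersection`, so adjacency unfolds to sums
-- of `δ` by `refl`.
δ : ∀ {n} → Fin n → Fin n → ℕ
δ a b = if toℕ a ≡ᵇ toℕ b then 1 else 0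

δ-≡ : ∀ {n} {a b : Fin n} → toℕ a ≡ toℕ b → δ a b ≡ 1
δ-≡ {a = a} {b} eq = if-yes (toℕ a ≟ toℕ b) eq

δ-≢ : ∀ {n} {a b : Fin n} → toℕ a ≢ toℕ b → δ a b ≡ 0
δ-≢ {a = a} {b} neq = if-no (toℕ a ≟ toℕ b) neq

δ-sym : ∀ {n} (a b : Fin n) → δ a b ≡ δ b a
δ-sym a b with toℕ a ≟ toℕ b
... | yes p = trans (δ-≡ p) (sym (δ-≡ (sym p)))
... | no p = trans (δ-≢ p) (sym (δ-≢ (p ∘ sym)))

module _ {n : ℕ} where
  open FinGraph (Johnson2 n)

  adj-δ : ∀ u w {a b c d} → δ (lo u) (lo w) ≡ a → δ (lo u) (hi w) ≡ b → δ (hi u) (lo w) ≡ c →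
    δ (hi u) (hi w) ≡ d → adj u w ≡ (a + b + c + d ≡ᵇ 1)
  adj-δ u w refl refl refl refl = refl

  adj-sym : ∀ u w → adj u w ≡ adj w u
  adj-sym u w = cong (_≡ᵇ 1) (begin
    δ (lo u) (lo w) + δ (lo u) (hi w) + δ (hi u) (lo w) + δ (hi u) (hi w)
      ≡⟨ cong (_+ δ (hi u) (hi w)) (+-assoc (δ (lo u) (lo w)) _ _) ⟩
    δ (lo u) (lo w) + (δ (lo u) (hi w) + δ (hi u) (lo w)) + δ (hi u) (hi w)
      ≡⟨ cong₂ _+_ (cong₂ _+_ (δ-sym (lo u) (lo w))
           (trans (+-comm (δ (lo u) (hi w)) _) (cong₂ _+_ (δ-sym (hi u) (lo w)) (δ-sym (lo u) (hi w)))))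
           (δ-sym (hi u) (hi w)) ⟩
    δ (lo w) (lo u) + (δ (lo w) (hi u) + δ (hi w) (lo u)) + δ (hi w) (hi u)
      ≡⟨ cong (_+ δ (hi w) (hi u)) (+-assoc (δ (lo w) (lo u)) _ _) ⟨
    δ (lo w) (lo u) + δ (lo w) (hi u) + δ (hi w) (lo u) + δ (hi w) (hi u) ∎)
    where open ≡-Reasoning

  adj-same-hi : ∀ u w → h u ≡ h w → u ≢ w → adj u w ≡ true
  adj-same-hi u w hu≡hw u≢w = adj-δ u w
    (δ-≢ (u≢w ∘ vertex-≡ hu≡hw))
    (δ-≢ (<⇒≢ (subst (l u <_) hu≡hw (l<h u))))
    (δ-≢ (>⇒≢ (subst (l w <_) (sym hu≡hw) (l<h w))))
    (δ-≡ hu≡hw)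

-- Upper bound: the contraction sequence of J(n,2), n = m + 2

module Johnson (m : ℕ) where

  n : ℕ
  n = suc (suc m)

  G : FinGraph
  G = Johnson2 n

  open FinGraph G using (V; adj)
  open RedDegree G

  -- Base n notation: for second entries below n, the numerical order is the lexicographic one.
  code : ℕ → ℕ → ℕ
  code a b = a * n + b

  code-< : ∀ {a b c} d → b < n → a < c → code a b < code c d
  code-< {a} {b} {c} d b<n a<c = begin-strict
    a * n + b <⟨ +-monoʳ-< (a * n) b<n ⟩
    a * n + n ≡⟨ +-comm (a * n) n ⟩
    suc a * n ≤⟨ *-monoˡ-≤ n a<c ⟩
    c * n     ≤⟨ m≤m+n (c * n) d ⟩
    c * n + d ∎
    where open ≤-Reasoning

  code-injective : ∀ {a b c d} → b < n → d < n → code a b ≡ code c d → a ≡ c × b ≡ d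
  code-injective {a} {b} {c} {d} b<n d<n eq with <-cmp a c
  ... | tri< a<c _ _ = contradiction eq (<⇒≢ (code-< d b<n a<c))
  ... | tri> _ _ c<a = contradiction eq (>⇒≢ (code-< b d<n c<a))
  ... | tri≈ _ refl _ = refl , +-cancelˡ-≡ (a * n) b d eq

  -- The stage at which a vertex is absorbed: {i, t} at stage t, but {i, 0}, which stands for the
  -- star {i} × T, at stage i.
  row : V → ℕ
  row v with l v
  ... | zero = h v
  ... | suc k = suc k

  row-cases : ∀ v → (l v ≡ 0 × row v ≡ h v) ⊎ (0 < l v × row v ≡ l v)
  row-cases v with l v
  ... | zero = inj₁ (refl , refl)
  ... | suc k = inj₂ (s≤s z≤n , refl)

  row≤h : ∀ v → row v ≤ h v
  row≤h v with row-cases v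
  ... | inj₁ (_ , eq) = ≤-reflexive eq
  ... | inj₂ (_ , eq) = subst (_≤ h v) (sym eq) (<⇒≤ (l<h v))

  0<row : ∀ v → 0 < row v
  0<row v with row-cases v
  ... | inj₁ (_ , eq) = subst (0 <_) (sym eq) (≤-<-trans z≤n (l<h v))
  ... | inj₂ (0<l , eq) = subst (0 <_) (sym eq) 0<l

  -- Stage t begins with {0, t}, whose absorption for t > 1 sends {t} × T into E(T), and goes on
  -- with {i, t} for i > t in increasing order.
  key : V → ℕ
  key v = code (row v) (h v)

  key-injective : ∀ {x y} → key x ≡ key y → x ≡ y
  key-injective {x} {y} eq with code-injective (h<n x) (h<n y) eq
  ... | r , hx≡hy = vertex-≡ hx≡hy (lows (row-cases x) (row-cases y))
    where
    lows : _ → _ → l x ≡ l y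
    lows (inj₁ (p , _)) (inj₁ (q , _)) = trans p (sym q)
    lows (inj₂ (_ , p)) (inj₂ (_ , q)) = trans (sym p) (trans r q)
    lows (inj₁ (_ , p)) (inj₂ (_ , q)) =
      contradiction (trans (sym q) (trans (sym r) (trans p hx≡hy))) (<⇒≢ (l<h y))
    lows (inj₂ (_ , p)) (inj₁ (_ , q)) =
      contradiction (trans (sym p) (trans r (trans q (sym hx≡hy)))) (<⇒≢ (l<h x))

  -- {0, i} represents the star {i} × T. Once it is absorbed itself, `top` passes the whole star on
  -- to E(T).
  parent : V → V
  parent v = hi v , zero , ≤-<-trans z≤n (l<h v)

  root : V
  root = suc zero , zero , s≤s z≤n

  root-least : ∀ x → key root ≤ key x
  root-least x = +-mono-≤ (*-monoˡ-≤ n (0<row x)) (≤-trans (0<row x) (row≤h x))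

  open Absorption G JVertices-complete (JVertices-unique n) key key-injective
    parent (λ x → vertex-≡ refl refl) root (vertex-≡ refl refl) root-least

  -- Red edges in the partition reached when `w` is absorbed

  module Threshold (w : V) where

    τ : ℕ
    τ = row w

    f : V → ℕ
    f = label (key w)

    -- inX: the part E(T ∪ {τ}), where T = {0, …, τ-1}. inM: the edges {i, s} with s ≤ τ < i, in the star
    -- of i (a = i) or still a singleton {i, τ} (a = τ). inC: the edges avoiding T ∪ {τ}.
    data View (x : V) : Set where
      inX : h x ≤ τ → f x ≡ 0 → View x
      inM : ∀ a → τ < h x → l x ≤ τ → a ≡ h x ⊎ a ≡ τ → f x ≡ suc (code a (h x)) → View x
      inC : τ < l x → f x ≡ suc (code (l x) (h x)) → View x

    -- An edge inside T ∪ {τ} has row below τ, unless it is {0, τ}; and {0, τ} comes first in its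
    -- stage, so it has been absorbed no later than `w`.
    below : ∀ x → h x ≤ τ → key x ≤ key w
    below x hx≤τ with m≤n⇒m<n∨m≡n (≤-trans (row≤h x) hx≤τ)
    ... | inj₁ r<τ = <⇒≤ (code-< (h w) (h<n x) r<τ)
    ... | inj₂ r≡τ = +-mono-≤ (*-monoˡ-≤ n (≤-reflexive r≡τ)) (≤-trans hx≤τ (row≤h w))

    label-row : ∀ x {a} → row x ≡ a → key w < key x → f x ≡ suc (code a (h x))
    label-row x refl w<x = label-> {x = x} w<x

    above : ∀ x {a} → row x ≡ a → τ < a → key w < key x
    above x refl τ<a = code-< (h x) (h<n w) τ<a

    view : ∀ x → View x
    view x with ≤-<-connex (h x) τ
    ... | inj₁ hx≤τ = inX hx≤τ (trans (label-≤ {x = x} (below x hx≤τ)) (top-≤ {x = parent x} (below (parent x) hx≤τ)))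
    ... | inj₂ τ<hx with ≤-<-connex (l x) τ | row-cases x
    ...   | inj₂ τ<lx | inj₁ (lx≡0 , _) = contradiction τ<lx (subst (λ k → ¬ (τ < k)) (sym lx≡0) λ ())
    ...   | inj₂ τ<lx | inj₂ (_ , r) = inC τ<lx (label-row x r (above x r τ<lx))
    ...   | inj₁ lx≤τ | inj₁ (_ , r) = inM (h x) τ<hx lx≤τ (inj₁ refl) (label-row x r (above x r τ<hx))
    ...   | inj₁ lx≤τ | inj₂ (_ , r) with ≤-<-connex (key x) (key w)
    ...     | inj₁ x≤w = inM (h x) τ<hx lx≤τ (inj₁ refl)
      (trans (label-≤ {x = x} x≤w) (top-> {x = parent x} (above (parent x) refl τ<hx)))
    -- All smaller rows have been passed, so an edge not yet absorbed with lower endpoint at most τ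
    -- is a singleton {i, τ}.
    ...     | inj₂ w<x = inM τ τ<hx lx≤τ (inj₂ refl) (label-row x row≡τ w<x)
      where
      row≡τ : row x ≡ τ
      row≡τ with m≤n⇒m<n∨m≡n (subst (_≤ τ) (sym r) lx≤τ)
      ... | inj₁ r<τ = contradiction (code-< (h w) (h<n x) r<τ) (<⇒≯ w<x)
      ... | inj₂ eq = eq

    code≡ : ∀ x y {a c} → f x ≡ f y → f x ≡ suc (code a (h x)) → f y ≡ suc (code c (h y)) → a ≡ c × h x ≡ h y
    code≡ x y {a} {c} eq p q =
      code-injective {a} {h x} {c} (h<n x) (h<n y) (suc-injective (trans (sym p) (trans eq q)))

    0≢code : ∀ {i j k} → i ≡ j → i ≡ 0 → j ≢ suc k
    0≢code refl refl ()

    -- Read as pairs, the star labels are diagonal and those of the singletons {i, τ} have first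
    -- entry τ, whereas (l y, h y) is off the diagonal with first entry above τ.
    M≢C : ∀ x y {a} → a ≡ h x ⊎ a ≡ τ → τ < l y →
      f x ≡ suc (code a (h x)) → f y ≡ suc (code (l y) (h y)) → f x ≢ f y
    M≢C x y a≡ τ<ly p q eq with code≡ x y eq p q | a≡
    ... | a≡ly , hx≡hy | inj₁ a≡hx = <⇒≢ (l<h y) (trans (sym a≡ly) (trans a≡hx hx≡hy))
    ... | a≡ly , _ | inj₂ a≡τ = <⇒≢ τ<ly (trans (sym a≡τ) a≡ly)

    -- The witnesses of a red edge are known only through their labels; this lemma, `sameM` and
    -- `sameC` recover what kind of edge they are.
    sameX : ∀ x y → h y ≤ τ → f x ≡ f y → h x ≤ τ
    sameX x y hy≤τ eq with view x | view y
    ... | inX p _ | _ = p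
    ... | inM _ _ _ _ p | inX _ q = contradiction p (0≢code (sym eq) q)
    ... | inC _ p | inX _ q = contradiction p (0≢code (sym eq) q)
    ... | _ | inM _ τ<hy _ _ _ = contradiction hy≤τ (<⇒≱ τ<hy)
    ... | _ | inC τ<ly _ = contradiction hy≤τ (<⇒≱ (<-trans τ<ly (l<h y)))

    sameM : ∀ x y → τ < h y → l y ≤ τ → f x ≡ f y → h x ≡ h y × l x ≤ τ
    sameM x y τ<hy ly≤τ eq with view x | view y
    ... | _ | inX hy≤τ _ = contradiction hy≤τ (<⇒≱ τ<hy)
    ... | _ | inC τ<ly _ = contradiction ly≤τ (<⇒≱ τ<ly)
    ... | inX _ p | inM _ _ _ _ q = contradiction q (0≢code eq p)
    ... | inM a _ lx≤τ _ p | inM c _ _ _ q = proj₂ (code≡ x y {a} {c} eq p q) , lx≤τ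
    ... | inC τ<lx p | inM _ _ _ a≡ q = contradiction (sym eq) (M≢C y x a≡ τ<lx q p)

    sameC : ∀ x y → τ < l y → f x ≡ f y → x ≡ y
    sameC x y τ<ly eq with view x | view y
    ... | _ | inX hy≤τ _ = contradiction hy≤τ (<⇒≱ (<-trans τ<ly (l<h y)))
    ... | _ | inM _ _ ly≤τ _ _ = contradiction ly≤τ (<⇒≱ τ<ly)
    ... | inX _ p | inC _ q = contradiction q (0≢code eq p)
    ... | inM _ _ _ a≡ p | inC _ q = contradiction eq (M≢C x y a≡ τ<ly p q)
    ... | inC _ p | inC _ q = let a , b = code≡ x y eq p q in vertex-≡ b a

    -- An edge `x` avoiding T ∪ {τ} meets no edge inside that set, and meets {i, s} with s ≤ τ < i
    -- at most in i, which the whole part shares. The remaining parts are singletons.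
    C-homogeneous : ∀ x y b d → τ < l x → f b ≡ f y → f d ≡ f y → adj x b ≡ adj x d
    C-homogeneous x y b d τ<lx fb fd with view y
    ... | inC τ<ly _ = cong (adj x) (trans (sameC b y τ<ly fb) (sym (sameC d y τ<ly fd)))
    ... | inX hy≤τ _ = trans (apart b (sameX b y hy≤τ fb)) (sym (apart d (sameX d y hy≤τ fd)))
      where
      apart : ∀ e → h e ≤ τ → adj x e ≡ false
      apart e he≤τ = adj-δ x e (δ-≢ (>⇒≢ le<lx)) (δ-≢ (>⇒≢ he<lx))
        (δ-≢ (>⇒≢ (<-trans le<lx (l<h x)))) (δ-≢ (>⇒≢ (<-trans he<lx (l<h x))))
        where
        he<lx : h e < l x
        he<lx = ≤-<-trans he≤τ τ<lx
        le<lx : l e < l x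
        le<lx = <-trans (l<h e) he<lx
    ... | inM _ τ<hy ly≤τ _ _ =
      trans (only-hi b (proj₂ (sameM b y τ<hy ly≤τ fb)))
        (trans (cong (λ e → δ (lo x) e + 0 + δ (hi x) e ≡ᵇ 1)
                 (toℕ-injective (trans (proj₁ (sameM b y τ<hy ly≤τ fb)) (sym (proj₁ (sameM d y τ<hy ly≤τ fd))))))
          (sym (only-hi d (proj₂ (sameM d y τ<hy ly≤τ fd)))))
      where
      only-hi : ∀ e → l e ≤ τ → adj x e ≡ (δ (lo x) (hi e) + 0 + δ (hi x) (hi e) ≡ᵇ 1)
      only-hi e le≤τ = adj-δ x e (δ-≢ (>⇒≢ (≤-<-trans le≤τ τ<lx))) refl
        (δ-≢ (>⇒≢ (<-trans (≤-<-trans le≤τ τ<lx) (l<h x)))) refl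

    red-sym : ∀ {x y} → Red f x y → Red f y x
    red-sym (red ne a b c d fa fb e fc fd e′) =
      red (ne ∘ sym) b a d c fb fa (trans (adj-sym b a) e) fd fc (trans (adj-sym d c) e′)

    C-not-red : ∀ {x y} → τ < l x → ¬ Red f x y
    C-not-red {x} {y} τ<lx (red ne a b c d fa fb e fc fd e′)
      with sameC a x τ<lx fa | sameC c x τ<lx fc
    ... | refl | refl with trans (sym e) (trans (C-homogeneous x y b d τ<lx fb fd) e′)
    ...   | ()

    -- Both parts consist of edges with the same upper endpoint, and distinct such edges are
    -- adjacent; differing labels keep the two witnesses of the non-edge distinct.
    M-not-red : ∀ {x y} → τ < h x → l x ≤ τ → l y ≤ τ → h x ≡ h y → ¬ Red f x y
    M-not-red {x} {y} τ<hx lx≤τ ly≤τ hx≡hy (red ne _ _ c d fa fb e fc fd e′)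
      with trans (sym e′) (adj-same-hi c d
             (trans (proj₁ (sameM c x τ<hx lx≤τ fc))
               (trans hx≡hy (sym (proj₁ (sameM d y (subst (τ <_) hx≡hy τ<hx) ly≤τ fd)))))
             (λ c≡d → ne (trans (sym fc) (trans (cong f c≡d) fd))))
    ... | ()

    adj-edge-01 : ∀ c d → h c ≤ 1 → l d ≤ 1 → 1 < h d → adj c d ≡ true
    adj-edge-01 c d hc≤1 ld≤1 1<hd with n≤0⇒n≡0 (s≤s⁻¹ (≤-trans (l<h c) hc≤1))
    ... | lc≡0 with m≤n⇒m<n∨m≡n ld≤1
    ...   | inj₁ ld<1 = adj-δ c d
      (δ-≡ (trans lc≡0 (sym (n≤0⇒n≡0 (s≤s⁻¹ ld<1)))))
      (δ-≢ (<⇒≢ (<-trans (≤-trans (l<h c) hc≤1) 1<hd)))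
      (δ-≢ (>⇒≢ (≤-trans ld<1 (≤-trans (s≤s z≤n) (l<h c)))))
      (δ-≢ (<⇒≢ (≤-<-trans hc≤1 1<hd)))
    ...   | inj₂ ld≡1 = adj-δ c d
      (δ-≢ (<⇒≢ (≤-trans (s≤s (≤-reflexive lc≡0)) (≤-reflexive (sym ld≡1)))))
      (δ-≢ (<⇒≢ (<-trans (≤-trans (l<h c) hc≤1) 1<hd)))
      (δ-≡ (trans (≤-antisym hc≤1 (≤-trans (s≤s z≤n) (l<h c))) (sym ld≡1)))
      (δ-≢ (<⇒≢ (≤-<-trans hc≤1 1<hd)))

    -- At stage 1 the part is {0, 1} alone, which meets every {i, s} with s ≤ 1 < i in exactly the
    -- point s.
    X-not-red : τ ≡ 1 → ∀ {x y} → h x ≤ τ → ¬ Red f x y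
    X-not-red τ≡1 {x} {y} hx≤τ r@(red ne _ _ c d fa fb e fc fd e′) with view y | view x
    ... | inC τ<ly _ | _ = C-not-red τ<ly (red-sym r)
    ... | inX _ fy≡0 | inX _ fx≡0 = ne (trans fx≡0 (sym fy≡0))
    ... | inX _ _ | inM _ τ<hx _ _ _ = <⇒≱ τ<hx hx≤τ
    ... | inX _ _ | inC τ<lx _ = <⇒≱ (<-trans τ<lx (l<h x)) hx≤τ
    ... | inM _ τ<hy ly≤τ _ _ | _ with sameM d y τ<hy ly≤τ fd
    ...   | hd≡hy , ld≤τ with trans (sym e′) (adj-edge-01 c d
                (subst (h c ≤_) τ≡1 (sameX c x hx≤τ fc)) (subst (l d ≤_) τ≡1 ld≤τ)
                (subst₂ _<_ τ≡1 (sym hd≡hy) τ<hy))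
    ...     | ()

    -- Counting the labels of red neighbours

    arm : ℕ → ℕ → ℕ
    arm a j = suc (code a j)

    width : ℕ
    width = n ∸ suc τ

    -- For each j > τ, the label of the star of j and that of the singleton {j, τ}. Some may be
    -- vacant, as {j, τ} may already be absorbed; the list serves for upper bounds.
    arms : List ℕ
    arms = applyUpTo (λ k → arm (suc τ + k) (suc τ + k)) width ++ applyUpTo (λ k → arm τ (suc τ + k)) width

    arms-length : length arms ≡ width + width
    arms-length = trans (length-++ (applyUpTo (λ k → arm (suc τ + k) (suc τ + k)) width))
      (cong₂ _+_ (length-applyUpTo _ width) (length-applyUpTo _ width))

    arm-diagonal : ∀ {j} → τ < j → j < n → arm j j ∈ arms
    arm-diagonal {j} τ<j j<n = ∈-++⁺ˡ (subst (λ i → arm i i ∈ applyUpTo (λ k → arm (suc τ + k) (suc τ + k)) width)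
      (m+[n∸m]≡n τ<j) (∈-applyUpTo⁺ (λ k → arm (suc τ + k) (suc τ + k)) (∸-monoˡ-< j<n τ<j)))

    arm-row : ∀ {j} → τ < j → j < n → arm τ j ∈ arms
    arm-row {j} τ<j j<n = ∈-++⁺ʳ (applyUpTo (λ k → arm (suc τ + k) (suc τ + k)) width)
      (subst (λ i → arm τ i ∈ applyUpTo (λ k → arm τ (suc τ + k)) width)
      (m+[n∸m]≡n τ<j) (∈-applyUpTo⁺ (λ k → arm τ (suc τ + k)) (∸-monoˡ-< j<n τ<j)))

    arm-∈ : ∀ (y : V) {a} → τ < h y → a ≡ h y ⊎ a ≡ τ → arm a (h y) ∈ arms
    arm-∈ y τ<hy (inj₁ refl) = arm-diagonal τ<hy (h<n y)
    arm-∈ y τ<hy (inj₂ refl) = arm-row τ<hy (h<n y)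

    doubled : ∀ {k} → k + k ≡ 2 * k
    doubled {k} = cong (k +_) (sym (+-identityʳ k))

    none : ∀ x → (∀ {y} → ¬ Red f x y) → redDeg G f x ≤ 2 * (n ∸ 3)
    none x nored = ≤-trans (redDeg-≤-minus f x {[]} {[]} [] id (λ y r → contradiction r nored)) z≤n

    wide : 1 < τ → length arms ≤ 2 * (n ∸ 3)
    wide 1<τ = ≤-trans (≤-reflexive (trans arms-length (doubled {width}))) (*-monoʳ-≤ 2 (∸-monoʳ-≤ n (s≤s 1<τ)))

    X-redDeg-≤ : ∀ x → h x ≤ τ → f x ≡ 0 → 1 < τ → redDeg G f x ≤ 2 * (n ∸ 3)
    X-redDeg-≤ x hx≤τ fx≡0 1<τ = ≤-trans (redDeg-≤-minus f x {[]} {arms} [] (λ ()) bound) (wide 1<τ)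
      where
      bound : ∀ y → Red f x y → f y ∈ arms × f y ∉ []
      bound y r = by (view y) , λ ()
        where
        by : View y → f y ∈ arms
        by (inX _ fy≡0) = contradiction (trans fx≡0 (sym fy≡0)) (Red.labels≢ r)
        by (inC τ<ly _) = contradiction (red-sym r) (C-not-red τ<ly)
        by (inM _ τ<hy _ a≡ fy) = subst (_∈ arms) (sym fy) (arm-∈ y τ<hy a≡)

    module _ (x : V) (τ<hx : τ < h x) (lx≤τ : l x ≤ τ) where

      -- The two candidates with the index of `x` itself, ruled out by `M-not-red`.
      own : List ℕ
      own = arm (h x) (h x) ∷ arm τ (h x) ∷ []

      own-unique : Unique own
      own-unique = ((λ eq → >⇒≢ τ<hx (proj₁ (code-injective {h x} {h x} {τ} (h<n x) (h<n x) (suc-injective eq)))) ∷ [])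
        ∷ [] ∷ []

      own-⊆ : own ⊆ arms
      own-⊆ (here refl) = arm-diagonal τ<hx (h<n x)
      own-⊆ (there (here refl)) = arm-row τ<hx (h<n x)

      own⁻ : ∀ {k} → k ∈ own → Σ[ a ∈ ℕ ] k ≡ arm a (h x)
      own⁻ (here eq) = h x , eq
      own⁻ (there (here eq)) = τ , eq

      neighbour : ∀ y → Red f x y → ((f y ≡ 0 × τ ≢ 1) ⊎ f y ∈ arms) × f y ∉ own
      neighbour y r = by (view y)
        where
        by : View y → ((f y ≡ 0 × τ ≢ 1) ⊎ f y ∈ arms) × f y ∉ own
        by (inX hy≤τ fy≡0) = inj₁ (fy≡0 , λ τ≡1 → X-not-red τ≡1 hy≤τ (red-sym r))
          , λ k∈ → 0≢1+n (trans (sym fy≡0) (proj₂ (own⁻ k∈)))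
        by (inC τ<ly _) = contradiction (red-sym r) (C-not-red τ<ly)
        by (inM c τ<hy ly≤τ c≡ fy) = inj₂ (subst (_∈ arms) (sym fy) (arm-∈ y τ<hy c≡))
          , λ k∈ → let b , eq = own⁻ k∈ in M-not-red τ<hx lx≤τ ly≤τ
              (proj₂ (code-injective {b} {h x} {c} (h<n x) (h<n y) (suc-injective (trans (sym eq) fy)))) r

      M-redDeg-≤ : 1 < τ ⊎ 1 ≡ τ → redDeg G f x ≤ 2 * (n ∸ 3)
      -- The label 0 of E(T ∪ {τ}) adds one candidate and `own` removes two, so even one less than
      -- the length of `arms` would be a bound.
      M-redDeg-≤ (inj₁ 1<τ) = ≤-trans (≤-trans (n≤1+n _)
          (s≤s⁻¹ (redDeg-≤-minus f x {own} {0 ∷ arms} own-unique (there ∘ own-⊆) bound))) (wide 1<τ)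
        where
        bound : ∀ y → Red f x y → f y ∈ 0 ∷ arms × f y ∉ own
        bound y r = by (proj₁ (neighbour y r)) , proj₂ (neighbour y r)
          where
          by : (f y ≡ 0 × τ ≢ 1) ⊎ f y ∈ arms → f y ∈ 0 ∷ arms
          by (inj₁ (fy≡0 , _)) = here fy≡0
          by (inj₂ fy∈) = there fy∈
      -- At stage 1 the label 0 drops out by `X-not-red`. There remain 2(n-2) - 2 candidates, which
      -- is 2m - 2, and `n ∸ 3` is `m ∸ 1`.
      M-redDeg-≤ (inj₂ 1≡τ) = shrink m
          (subst (2 + redDeg G f x ≤_) (trans arms-length (cong (λ t → (n ∸ suc t) + (n ∸ suc t)) (sym 1≡τ)))
            (redDeg-≤-minus f x {own} {arms} own-unique own-⊆ bound))
        where
        bound : ∀ y → Red f x y → f y ∈ arms × f y ∉ own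
        bound y r = by (proj₁ (neighbour y r)) , proj₂ (neighbour y r)
          where
          by : (f y ≡ 0 × τ ≢ 1) ⊎ f y ∈ arms → f y ∈ arms
          by (inj₁ (_ , τ≢1)) = contradiction (sym 1≡τ) τ≢1
          by (inj₂ fy∈) = fy∈

        shrink : ∀ m {d} → 2 + d ≤ m + m → d ≤ 2 * (m ∸ 1)
        shrink zero ()
        shrink (suc m) le = ≤-trans (s≤s⁻¹ (≤-trans (s≤s⁻¹ le) (≤-reflexive (+-suc m m)))) (≤-reflexive (doubled {m}))

    redDeg-≤ : ∀ x → redDeg G f x ≤ 2 * (n ∸ 3)
    redDeg-≤ x = by (view x) (m≤n⇒m<n∨m≡n (0<row w))
      where
      by : View x → 1 < τ ⊎ 1 ≡ τ → redDeg G f x ≤ 2 * (n ∸ 3)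
      by (inC τ<lx _) _ = none x (C-not-red τ<lx)
      by (inX hx≤τ _) (inj₂ 1≡τ) = none x (X-not-red (sym 1≡τ) hx≤τ)
      by (inX hx≤τ fx≡0) (inj₁ 1<τ) = X-redDeg-≤ x hx≤τ fx≡0 1<τ
      by (inM _ τ<hx lx≤τ _ _) = M-redDeg-≤ x τ<hx lx≤τ

  upper-sequence : Σ[ P ∈ (ℕ → V → ℕ) ] ContractionSequence G P × WidthAtMost G P (2 * (n ∸ 3))
  upper-sequence = sequence (λ w → maxRedDeg-≤ _ (Threshold.redDeg-≤ w))

-- Merging two vertices of J(n,2)

length-cartesianProduct : {A B : Set} (xs : List A) (ys : List B) →
  length (cartesianProduct xs ys) ≡ length xs * length ys
length-cartesianProduct [] ys = refl
length-cartesianProduct (x ∷ xs) ys = trans (length-++ (map (x ,_) ys))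
  (cong₂ _+_ (length-map (x ,_) ys) (length-cartesianProduct xs ys))

module Merging {n : ℕ} where

  open FinGraph (Johnson2 n) using (V; adj)
  open RedDegree (Johnson2 n)
  open Complete JVertices-complete
  open DecMembership (Fin._≟_ {n}) using (_∈?_)

  Pair : V → Fin n → Fin n → Set
  Pair w x k = (lo w ≡ x × hi w ≡ k) ⊎ (lo w ≡ k × hi w ≡ x)

  _∈ᵥ_ : Fin n → V → Set
  x ∈ᵥ u = x ≡ lo u ⊎ x ≡ hi u

  lo≢hi : ∀ (u : V) → lo u ≢ hi u
  lo≢hi u eq = <⇒≢ (l<h u) (cong toℕ eq)

  -- The first argument is a junk value, returned when the two elements coincide.
  pair : V → Fin n → Fin n → V
  pair u x k with <-cmp (toℕ x) (toℕ k)
  ... | tri< x<k _ _ = k , x , x<k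
  ... | tri≈ _ _ _ = u
  ... | tri> _ _ k<x = x , k , k<x

  pair-Pair : ∀ u {x k} → x ≢ k → Pair (pair u x k) x k
  pair-Pair u {x} {k} x≢k with <-cmp (toℕ x) (toℕ k)
  ... | tri< _ _ _ = inj₁ (refl , refl)
  ... | tri≈ _ eq _ = contradiction (toℕ-injective eq) x≢k
  ... | tri> _ _ _ = inj₂ (refl , refl)

  Pair-∈ʳ : ∀ w {x k} → Pair w x k → k ∈ᵥ w
  Pair-∈ʳ w (inj₁ (_ , eq)) = inj₂ (sym eq)
  Pair-∈ʳ w (inj₂ (eq , _)) = inj₁ (sym eq)

  private
    eq1 : {a b : Fin n} → a ≡ b → δ a b ≡ 1
    eq1 = δ-≡ ∘ cong toℕ

    ne0 : {a b : Fin n} → a ≢ b → δ a b ≡ 0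
    ne0 neq = δ-≢ (neq ∘ toℕ-injective)

  adj-outside : ∀ u w {x k} → ¬ x ∈ᵥ u → ¬ k ∈ᵥ u → Pair w x k → adj u w ≡ false
  adj-outside u w x∉u k∉u (inj₁ (refl , refl)) = adj-δ u w
    (ne0 (x∉u ∘ inj₁ ∘ sym)) (ne0 (k∉u ∘ inj₁ ∘ sym)) (ne0 (x∉u ∘ inj₂ ∘ sym)) (ne0 (k∉u ∘ inj₂ ∘ sym))
  adj-outside u w x∉u k∉u (inj₂ (refl , refl)) = adj-δ u w
    (ne0 (k∉u ∘ inj₁ ∘ sym)) (ne0 (x∉u ∘ inj₁ ∘ sym)) (ne0 (k∉u ∘ inj₂ ∘ sym)) (ne0 (x∉u ∘ inj₂ ∘ sym))

  adj-inside : ∀ u w {x k} → x ∈ᵥ u → ¬ k ∈ᵥ u → Pair w x k → adj u w ≡ true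
  adj-inside u w (inj₁ x≡) k∉u (inj₁ (refl , refl)) = adj-δ u w
    (eq1 (sym x≡)) (ne0 (k∉u ∘ inj₁ ∘ sym)) (ne0 (λ eq → lo≢hi u (sym (trans eq x≡)))) (ne0 (k∉u ∘ inj₂ ∘ sym))
  adj-inside u w (inj₁ x≡) k∉u (inj₂ (refl , refl)) = adj-δ u w
    (ne0 (k∉u ∘ inj₁ ∘ sym)) (eq1 (sym x≡)) (ne0 (k∉u ∘ inj₂ ∘ sym)) (ne0 (λ eq → lo≢hi u (sym (trans eq x≡))))
  adj-inside u w (inj₂ x≡) k∉u (inj₁ (refl , refl)) = adj-δ u w
    (ne0 (λ eq → lo≢hi u (trans eq x≡))) (ne0 (k∉u ∘ inj₁ ∘ sym)) (eq1 (sym x≡)) (ne0 (k∉u ∘ inj₂ ∘ sym))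
  adj-inside u w (inj₂ x≡) k∉u (inj₂ (refl , refl)) = adj-δ u w
    (ne0 (k∉u ∘ inj₁ ∘ sym)) (ne0 (λ eq → lo≢hi u (trans eq x≡))) (ne0 (k∉u ∘ inj₂ ∘ sym)) (eq1 (sym x≡))

  Separates : Fin n → V → V → Set
  Separates x u v = (x ∈ᵥ u × ¬ x ∈ᵥ v) ⊎ (x ∈ᵥ v × ¬ x ∈ᵥ u)

  -- For x in `S` and k outside `E`, the edge {x, k} is adjacent to exactly one of u and v, hence
  -- red to the merged part. As no such k lies in `S`, different pairs (x, k) give different edges.
  merged-redDeg-≥ : ∀ {u v f} → PairPartition (Johnson2 n) u v f → (S E : List (Fin n)) → Unique S →
    (∀ {x} → x ∈ S → Separates x u v) → (∀ {x} → x ∈ᵥ u ⊎ x ∈ᵥ v → x ∈ E) →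
    length S * (n ∸ length E) ≤ redDeg (Johnson2 n) f u
  merged-redDeg-≥ {u} {v} {f} part S E uS sep cover = begin
    length S * (n ∸ length E)           ≤⟨ *-monoʳ-≤ (length S) (m≤n+o⇒m∸n≤o n (length E) K-length) ⟩
    length S * length K                 ≡⟨ length-cartesianProduct S K ⟨
    length (cartesianProduct S K)       ≡⟨ length-map vertex (cartesianProduct S K) ⟨
    length ws                           ≤⟨ redDeg-≥ f u (unique-map-∈ f f-injective ws-unique) ws-red ⟩
    redDeg (Johnson2 n) f u             ∎
    where
    open ≤-Reasoning

    K : List (Fin n)
    K = filter (λ k → ¬? (k ∈? E)) (allFin n)

    K-length : n ≤ length E + length K
    K-length = subst₂ _≤_ (length-tabulate id) (length-++ E) (unique-⊆⇒length≤ (Unique.allFin⁺ n) λ {k} _ → split k)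
      where
      split : ∀ k → k ∈ E ++ K
      split k with k ∈? E
      ... | yes k∈E = ∈-++⁺ˡ k∈E
      ... | no k∉E = ∈-++⁺ʳ E (∈-filter⁺ _ (∈-allFin k) k∉E)

    K-outside : ∀ {k} → k ∈ K → (¬ k ∈ᵥ u) × (¬ k ∈ᵥ v)
    K-outside k∈K with ∈-filter⁻ _ {xs = allFin n} k∈K
    ... | _ , k∉E = k∉E ∘ cover ∘ inj₁ , k∉E ∘ cover ∘ inj₂

    S≢K : ∀ {x k} → x ∈ S → k ∈ K → x ≢ k
    S≢K x∈S k∈K refl with sep x∈S | K-outside k∈K
    ... | inj₁ (x∈u , _) | k∉u , _ = k∉u x∈u
    ... | inj₂ (x∈v , _) | _ , k∉v = k∉v x∈v

    vertex : Fin n × Fin n → V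
    vertex (x , k) = pair u x k

    ws : List V
    ws = map vertex (cartesianProduct S K)

    ws⁻ : ∀ {w} → w ∈ ws → Σ[ x ∈ Fin n ] Σ[ k ∈ Fin n ] x ∈ S × k ∈ K × Pair w x k
    ws⁻ w∈ with ∈-map⁻ vertex w∈
    ... | (x , k) , xk∈ , refl with ∈-cartesianProduct⁻ S K xk∈
    ...   | x∈S , k∈K = x , k , x∈S , k∈K , pair-Pair u (S≢K x∈S k∈K)

    ws-unique : Unique ws
    ws-unique = unique-map-∈ vertex inj (Unique.cartesianProduct⁺ uS (Unique.filter⁺ _ (Unique.allFin⁺ n)))
      where
      inj : ∀ {p q} → p ∈ cartesianProduct S K → q ∈ cartesianProduct S K → vertex p ≡ vertex q → p ≡ q
      inj {x , k} {y , j} p∈ q∈ eq with ∈-cartesianProduct⁻ S K p∈ | ∈-cartesianProduct⁻ S K q∈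
      ... | x∈S , k∈K | y∈S , j∈K
        with pair-Pair u (S≢K x∈S k∈K) | subst (λ w → Pair w y j) (sym eq) (pair-Pair u (S≢K y∈S j∈K))
      ...   | inj₁ (a , b) | inj₁ (c , d) = cong₂ _,_ (trans (sym a) c) (trans (sym b) d)
      ...   | inj₂ (a , b) | inj₂ (c , d) = cong₂ _,_ (trans (sym b) d) (trans (sym a) c)
      ...   | inj₁ (a , b) | inj₂ (c , d) = contradiction (trans (sym a) c) (S≢K x∈S j∈K)
      ...   | inj₂ (a , b) | inj₁ (c , d) = contradiction (trans (sym b) d) (S≢K x∈S j∈K)

    ws-≢ : ∀ {w} → w ∈ ws → w ≢ u × w ≢ v
    ws-≢ w∈ with ws⁻ w∈
    ... | x , k , _ , k∈K , p = (λ where refl → proj₁ (K-outside k∈K) (Pair-∈ʳ u p))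
                              , (λ where refl → proj₂ (K-outside k∈K) (Pair-∈ʳ v p))

    f-injective : ∀ {w z} → w ∈ ws → z ∈ ws → f w ≡ f z → w ≡ z
    f-injective {w} {z} w∈ z∈ eq with proj₁ (part w z) eq
    ... | inj₁ w≡z = w≡z
    ... | inj₂ (inj₁ (w≡u , _)) = contradiction w≡u (proj₁ (ws-≢ w∈))
    ... | inj₂ (inj₂ (w≡v , _)) = contradiction w≡v (proj₂ (ws-≢ w∈))

    fv≡fu : f v ≡ f u
    fv≡fu = proj₂ (part v u) (inj₂ (inj₂ (refl , refl)))

    fu≢fw : ∀ {w} → w ∈ ws → f u ≢ f w
    fu≢fw {w} w∈ eq with proj₁ (part u w) eq
    ... | inj₁ u≡w = proj₁ (ws-≢ w∈) (sym u≡w)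
    ... | inj₂ (inj₁ (_ , w≡v)) = proj₂ (ws-≢ w∈) w≡v
    ... | inj₂ (inj₂ (_ , w≡u)) = proj₁ (ws-≢ w∈) w≡u

    ws-red : ∀ {w} → w ∈ ws → Red f u w
    ws-red {w} w∈ with ws⁻ w∈
    ... | x , k , x∈S , k∈K , p with K-outside k∈K | sep x∈S
    ...   | k∉u , k∉v | inj₁ (x∈u , x∉v) =
      red (fu≢fw w∈) u w v w refl refl (adj-inside u w x∈u k∉u p) fv≡fu refl (adj-outside v w x∉v k∉v p)
    ...   | k∉u , k∉v | inj₂ (x∈v , x∉u) =
      red (fu≢fw w∈) v w u w fv≡fu refl (adj-inside v w x∈v k∉v p) refl refl (adj-outside u w x∉u k∉u p)

  ∈ᵥ-Pair : ∀ w {x k y} → Pair w x k → y ∈ᵥ w → y ≡ x ⊎ y ≡ k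
  ∈ᵥ-Pair w (inj₁ (p , q)) (inj₁ r) = inj₁ (trans r p)
  ∈ᵥ-Pair w (inj₁ (p , q)) (inj₂ r) = inj₂ (trans r q)
  ∈ᵥ-Pair w (inj₂ (p , q)) (inj₁ r) = inj₂ (trans r p)
  ∈ᵥ-Pair w (inj₂ (p , q)) (inj₂ r) = inj₁ (trans r q)

  Pair-≢ : ∀ w {x k} → Pair w x k → x ≢ k
  Pair-≢ w (inj₁ (refl , refl)) eq = lo≢hi w eq
  Pair-≢ w (inj₂ (refl , refl)) eq = lo≢hi w (sym eq)

  -- The two elements b and c separate u = {a, b} from v = {a, c}, and n - 3 points lie outside
  -- both.
  overlapping : ∀ {u v f a b c} → PairPartition (Johnson2 n) u v f → Pair u a b → Pair v a c → b ≢ c →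
    2 * (n ∸ 3) ≤ redDeg (Johnson2 n) f u
  overlapping {u} {v} {f} {a} {b} {c} part pu pv b≢c =
    merged-redDeg-≥ part (b ∷ c ∷ []) (a ∷ b ∷ c ∷ []) ((b≢c ∷ []) ∷ [] ∷ []) sep cover
    where
    sep : ∀ {x} → x ∈ b ∷ c ∷ [] → Separates x u v
    sep (here refl) = inj₁ (Pair-∈ʳ u pu , λ b∈v → [ Pair-≢ u pu ∘ sym , b≢c ]′ (∈ᵥ-Pair v pv b∈v))
    sep (there (here refl)) = inj₂ (Pair-∈ʳ v pv , λ c∈u → [ Pair-≢ v pv ∘ sym , b≢c ∘ sym ]′ (∈ᵥ-Pair u pu c∈u))

    cover : ∀ {x} → x ∈ᵥ u ⊎ x ∈ᵥ v → x ∈ a ∷ b ∷ c ∷ []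
    cover (inj₁ x∈u) with ∈ᵥ-Pair u pu x∈u
    ... | inj₁ p = here p
    ... | inj₂ p = there (here p)
    cover (inj₂ x∈v) with ∈ᵥ-Pair v pv x∈v
    ... | inj₁ p = here p
    ... | inj₂ p = there (there (here p))

  -- All four elements separate u from v, so `E` serves as both lists.
  disjoint : ∀ {u v f} → PairPartition (Johnson2 n) u v f →
    lo u ≢ lo v → lo u ≢ hi v → hi u ≢ lo v → hi u ≢ hi v →
    4 * (n ∸ 4) ≤ redDeg (Johnson2 n) f u
  disjoint {u} {v} part ll lh hl hh = merged-redDeg-≥ part E E
      ((lo≢hi u ∷ ll ∷ lh ∷ []) ∷ (hl ∷ hh ∷ []) ∷ (lo≢hi v ∷ []) ∷ [] ∷ []) sep cover
    where
    E : List (Fin n)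
    E = lo u ∷ hi u ∷ lo v ∷ hi v ∷ []

    sep : ∀ {x} → x ∈ E → Separates x u v
    sep (here refl) = inj₁ (inj₁ refl , λ where (inj₁ p) → ll p
                                                (inj₂ p) → lh p)
    sep (there (here refl)) = inj₁ (inj₂ refl , λ where (inj₁ p) → hl p
                                                        (inj₂ p) → hh p)
    sep (there (there (here refl))) = inj₂ (inj₁ refl , λ where (inj₁ p) → ll (sym p)
                                                                (inj₂ p) → hl (sym p))
    sep (there (there (there (here refl)))) = inj₂ (inj₂ refl , λ where (inj₁ p) → lh (sym p)
                                                                        (inj₂ p) → hh (sym p))

    cover : ∀ {x} → x ∈ᵥ u ⊎ x ∈ᵥ v → x ∈ E
    cover (inj₁ (inj₁ p)) = here p
    cover (inj₁ (inj₂ p)) = there (here p)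
    cover (inj₂ (inj₁ p)) = there (there (here p))
    cover (inj₂ (inj₂ p)) = there (there (there (here p)))

  merged-maxRedDeg-≥ : 5 ≤ n → ∀ u v f → u ≢ v → PairPartition (Johnson2 n) u v f →
    2 * (n ∸ 3) ≤ maxRedDeg (Johnson2 n) f
  merged-maxRedDeg-≥ 5≤n u v f u≢v part = ≤-trans bound (redDeg≤maxRedDeg f u)
    where
    -- The difference of the two sides is 2(n-5): equality at n = 5, and failure at n = 4.
    four-two : ∀ {n} → 5 ≤ n → 2 * (n ∸ 3) ≤ 4 * (n ∸ 4)
    four-two {suc (suc (suc (suc (suc k))))} (s≤s (s≤s (s≤s (s≤s (s≤s z≤n))))) = begin
      2 * (2 + k)       ≤⟨ *-monoʳ-≤ 2 (+-monoʳ-≤ 2 (m≤m+n k (k + 0))) ⟩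
      2 * (2 + 2 * k)   ≡⟨ cong (2 *_) (*-distribˡ-+ 2 1 k) ⟨
      2 * (2 * (1 + k)) ≡⟨ *-assoc 2 2 (1 + k) ⟨
      4 * (1 + k)       ∎
      where open ≤-Reasoning

    bound : 2 * (n ∸ 3) ≤ redDeg (Johnson2 n) f u
    bound with lo u Fin.≟ lo v | lo u Fin.≟ hi v | hi u Fin.≟ lo v | hi u Fin.≟ hi v
    ... | yes p | _ | _ | _ = overlapping part (inj₁ (refl , refl)) (inj₁ (sym p , refl))
      (λ q → u≢v (vertex-≡ (cong toℕ q) (cong toℕ p)))
    ... | no _ | yes p | _ | _ = overlapping part (inj₁ (refl , refl)) (inj₂ (refl , sym p))
      (λ q → <-asym (l<h u) (subst₂ _<_ (cong toℕ (sym q)) (cong toℕ (sym p)) (l<h v)))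
    ... | no _ | no _ | yes p | _ = overlapping part (inj₂ (refl , refl)) (inj₁ (sym p , refl))
      (λ q → <-asym (l<h u) (subst₂ _<_ (cong toℕ (sym p)) (cong toℕ (sym q)) (l<h v)))
    ... | no ll | no _ | no _ | yes p = overlapping part (inj₂ (refl , refl)) (inj₂ (refl , sym p)) ll
    ... | no ll | no lh | no hl | no hh = ≤-trans (four-two 5≤n) (disjoint part ll lh hl hh)

-- The octahedron J(4,2): first merge the three pairs of antipodal vertices.

module Octahedron where

  open FinGraph (Johnson2 4) using (V)

  everywhere : {P : V → Set} → All P (JVertices 4) → ∀ v → P v
  everywhere ps v = All.lookup ps (JVertices-complete v)

  v₁₀ v₂₀ v₃₀ v₂₁ v₃₁ v₃₂ : V
  v₁₀ = suc zero , zero , s≤s z≤n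
  v₂₀ = suc (suc zero) , zero , s≤s z≤n
  v₃₀ = suc (suc (suc zero)) , zero , s≤s z≤n
  v₂₁ = suc (suc zero) , suc zero , s≤s (s≤s z≤n)
  v₃₁ = suc (suc (suc zero)) , suc zero , s≤s (s≤s z≤n)
  v₃₂ = suc (suc (suc zero)) , suc (suc zero) , s≤s (s≤s (s≤s z≤n))

  -- The order of absorption: the root {2, 3}; its antipode {0, 1}, which joins it at once; {0, 2}
  -- and {0, 3}, which join their antipodes; finally {1, 2} and {1, 3}, each taking an antipodal
  -- pair into the root part. The last default stands for {1, 3}.
  rank : ℕ → ℕ → ℕ
  rank 3 2 = 0
  rank 1 0 = 1
  rank 2 0 = 2
  rank 3 0 = 3
  rank 2 1 = 4
  rank _ _ = 5

  unrank : ℕ → V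
  unrank 0 = v₃₂
  unrank 1 = v₁₀
  unrank 2 = v₂₀
  unrank 3 = v₃₀
  unrank 4 = v₂₁
  unrank _ = v₃₁

  key : V → ℕ
  key v = rank (h v) (l v)

  unrank-key : ∀ v → unrank (key v) ≡ v
  unrank-key = everywhere (vertex-≡ refl refl ∷ vertex-≡ refl refl ∷ vertex-≡ refl refl
    ∷ vertex-≡ refl refl ∷ vertex-≡ refl refl ∷ vertex-≡ refl refl ∷ [])

  key-injective : ∀ {x y} → key x ≡ key y → x ≡ y
  key-injective {x} {y} eq = trans (sym (unrank-key x)) (trans (cong unrank eq) (unrank-key y))

  antipode : ℕ → V → V
  antipode 2 _ = v₃₁
  antipode 3 _ = v₂₁
  antipode _ v = v

  parent : V → V
  parent v = antipode (key v) v

  open Absorption (Johnson2 4) JVertices-complete (JVertices-unique 4) key key-injective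
    parent (everywhere (refl ∷ refl ∷ refl ∷ refl ∷ refl ∷ refl ∷ [])) v₃₂ refl (λ _ → z≤n)

  -- Each of the six partitions is evaluated outright and has no red edge.
  width : ∀ v → maxRedDeg (Johnson2 4) (label (key v)) ≤ 0
  width = everywhere (≤-reflexive refl ∷ ≤-reflexive refl ∷ ≤-reflexive refl
    ∷ ≤-reflexive refl ∷ ≤-reflexive refl ∷ ≤-reflexive refl ∷ [])

  upper-sequence : Σ[ P ∈ (ℕ → V → ℕ) ] ContractionSequence (Johnson2 4) P × WidthAtMost (Johnson2 4) P 0
  upper-sequence = sequence width

-- The case distinction on n

2≤order : ∀ k → 2 ≤ order (Johnson2 (3 + k))
2≤order k = unique-⊆⇒length≤ {xs = first ∷ second ∷ []} (((λ ()) ∷ []) ∷ [] ∷ []) (λ {v} _ → JVertices-complete v)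
  where
  first second : JVertex (3 + k)
  first = suc zero , zero , s≤s z≤n
  second = suc (suc zero) , zero , s≤s z≤n

theorem4p4 : (n : ℕ) → 2 ≤ n → IsTww (Johnson2 n) (johnsonValue n) × IsLb1 (Johnson2 n) (johnsonValue n)
theorem4p4 0 ()
theorem4p4 1 (s≤s ())
-- J(2,2) has one vertex, so the convention for `IsLb1` applies; the general bound `2 * (n ∸ 3)` is
-- 0 by truncated subtraction.
theorem4p4 2 _ = (Johnson.upper-sequence 0 , λ _ _ _ _ → z≤n) , inj₁ (refl , refl)
theorem4p4 3 _ = Contraction.tww-and-lb₁ (Johnson2 3) (2≤order 0) (Johnson.upper-sequence 1) (λ _ _ _ _ _ → z≤n)
-- The general sequence would only give width at most 2 here.
theorem4p4 4 _ = Contraction.tww-and-lb₁ (Johnson2 4) (2≤order 1) Octahedron.upper-sequence (λ _ _ _ _ _ → z≤n)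
theorem4p4 (suc (suc (suc (suc (suc k))))) _ =
  Contraction.tww-and-lb₁ (Johnson2 (5 + k)) (2≤order (2 + k))
    (Johnson.upper-sequence (3 + k)) (Merging.merged-maxRedDeg-≥ (s≤s (s≤s (s≤s (s≤s (s≤s z≤n))))))
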